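{- For every integer $h\ge 4$, there exists a $(2h-1)$-uniform hypergraph $\mathcal H$ which has no polychromatic $3$-coloring, but all of whose $h$-heavy restricted subhypergraphs are $2$-colorable.
   Context: A hypergraph $\mathcal H=(V,E)$ is a collection $E$ of subsets of a vertex set $V$. It is $m$-uniform if all its edges have size $m$, and $h$-heavy if all its edges have size at least $h$. For $X\subset V$, the trace of $\mathcal H$ on $X$ is $\mathcal H[X]=(X,\{e\cap X:e\in E\})$. A restricted subhypergraph of $\mathcal H$ is a subhypergraph of a trace $\mathcal H[X]$ (i.e., a hypergraph on $X$ whose edges form a subfamily of the edges of $\mathcal H[X]$). A coloring of the vertices with colors $1,\dots,k$ is polychromatic if every edge contains all $k$ colors; a hypergraph is $2$-colorable if it has a polychromatic $2$-coloring, i.e., a red–blue coloring of its vertices with no monochromatic edge. -}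

module Defs where

open import Data.Nat using (ℕ; _≤_; _≡ᵇ_)
open import Data.Fin using (Fin)
open import Data.Fin.Subset using (Subset; _∈_; _∩_; ∣_∣)
open import Data.List using (List; map)
open import Data.List.Relation.Unary.All using (All)
open import Data.List.Relation.Binary.Sublist.Propositional using (_⊆_)
open import Data.Product using (Σ; ∃; _×_; _,_)
open import Relation.Binary.PropositionalEquality using (_≡_)

record Hypergraph : Set where
  constructor hypergraph
  field
    n     : ℕ
    edges : List (Subset n)
open Hypergraph public

Uniform : ℕ → Hypergraph → Set
Uniform m H = All (λ e → ∣ e ∣ ≡ m) (edges H)

Heavy : ℕ → Hypergraph → Set
Heavy h H = All (λ e → h ≤ ∣ e ∣) (edges H)

PolychromaticFor : {n k : ℕ} → (Fin n → Fin k) → List (Subset n) → Set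
PolychromaticFor {n} {k} c F = All (λ e → (i : Fin k) → ∃ λ v → v ∈ e × c v ≡ i) F

HasPolychromatic : ℕ → Hypergraph → Set
HasPolychromatic k H = Σ (Fin (n H) → Fin k) λ c → PolychromaticFor c (edges H)

TwoColorable : Hypergraph → Set
TwoColorable H = HasPolychromatic 2 H

traceEdges : (H : Hypergraph) → Subset (n H) → List (Subset (n H))
traceEdges H X = map (λ e → e ∩ X) (edges H)

-- A restricted subhypergraph of H on X ⊆ V: a subfamily F of the trace edges.
-- (The vertices are those of X; we keep the ambient index type Fin n.
--  Since every edge of F lies inside X, colourings of X and of Fin n
--  agree on what matters.)
RestrictedSub : (H : Hypergraph) → Subset (n H) → List (Subset (n H)) → Set
RestrictedSub H X F = F ⊆ traceEdges H X

AllHeavyRestrictedTwoColorable : ℕ → Hypergraph → Set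
AllHeavyRestrictedTwoColorable h H =
  (X : Subset (n H)) (F : List (Subset (n H))) →
  RestrictedSub H X F → Heavy h (hypergraph (n H) F) →
  TwoColorable (hypergraph (n H) F)

{-# OPTIONS --safe #-}

-- Write h = k + 1. Fix for every vertex set X a red-blue colouring of X. It suffices to find, for every
-- 3-colouring, a (2k+1)-set missing a colour whose monochromatic traces all have at most k vertices: these
-- sets, one per 3-colouring, form the hypergraph. Say that a set with s vertices whose monochromatic traces
-- have at most d vertices has type (s, d); types of disjoint sets add up, and the goal is type (2k+1, k).
--
-- Alternating the colours of X along a path makes consecutive pairs of type (2, 1) and consecutive triples of
-- type (3, 1). A long bundle of paths contains either a consecutive pair missing a prescribed colour or k + 1
-- paths with consecutive triples missing a common colour, and then one triple and k pairs have type
-- (2k+3, k+1). So a bundle turns a solution for h into one for h + 1, and the case h = 4 remains.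
--
-- For h = 4 take a 4-set Q whose traces are alternated. If Q misses a colour, it has type (4, 1) and is
-- completed by a pair and a vertex from two bundles. Otherwise Q is coloured a, a, b, c. The triples aac and
-- aab miss b and c, and at most one of them has a monochromatic trace of size two. For each possible position
-- of the pair a, a there is a private Fano plane. If at most one of its points has colour a, six of the others
-- together with b or c form an edge missing a. Otherwise five of its points miss b or c; they contain the
-- complement of a line, which together with aac or aab is an edge. That the points of the Fano planes can
-- always be coloured is checked exhaustively.

module Submission where

open import Defs
open import Data.Bool using (Bool; true; false; if_then_else_; T; _∧_; _∨_)
open import Data.Bool.Properties using (T-∧; T-≡) renaming (_≟_ to _≟ᵇ_)
open import Data.Bool.ListAction using (all)
open import Data.Fin using (Fin; zero; suc; punchIn; #_)
open import Data.Fin.Properties using (_≟_; any?; all?; +↔⊎; *↔×)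
open import Data.Fin.Subset using (Subset; inside; outside; ⁅_⁆; _∪_; _∩_; ∣_∣) renaming (_∈_ to _∈ₛ_; ⊥ to ∅)
open import Data.Fin.Subset.Properties using (∉⊥; ∣⊥∣≡0; x∈⁅x⁆; x∈⁅y⁆⇒x≡y; x∈p∪q⁺; x∈p∪q⁻; x∈p∩q⁺; ∪-identityˡ; ∩-zeroˡ)
open import Data.List using (List; []; _∷_; _++_; map; foldr; take; length; allFin; cartesianProductWith)
open import Data.List.Properties using (length-++; length-map)
open import Data.List.Membership.Propositional using (_∈_; find)
open import Data.List.Membership.Propositional.Properties using (∈-cartesianProductWith⁺; ∈-allFin; ∈-map⁻)
open import Data.List.Relation.Binary.Sublist.Propositional using () renaming (lookup to ⊆-lookup)
open import Data.List.Relation.Unary.All as All using (All; []; _∷_)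
import Data.List.Relation.Unary.All.Properties as AllP
open import Data.List.Relation.Unary.AllPairs using ([]; _∷_)
open import Data.List.Relation.Unary.Any as Any using (Any; here; there)
import Data.List.Relation.Unary.Any.Properties as AnyP
open import Data.List.Relation.Unary.Unique.Propositional using (Unique)
import Data.List.Relation.Unary.Unique.Propositional.Properties as UniqueP
import Data.List.Relation.Unary.Unique.DecPropositional as DecUnique
open import Data.Nat using (ℕ; zero; suc; _+_; _*_; _∸_; _≤_; _<_; z≤n; s≤s; _≤ᵇ_)
import Data.Nat.Properties as ℕ
open import Data.Product using (Σ; ∃; _×_; _,_; proj₁; proj₂)
open import Data.Sum using (_⊎_; inj₁; inj₂; [_,_]′)
import Data.Sum as Sum
open import Data.Sum.Function.Propositional using (_⊎-↔_)
open import Data.Sum.Properties using (inj₁-injective; inj₂-injective)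
import Data.Sum.Properties as SumP
open import Data.Unit using (tt)
open import Data.Vec using (Vec; []; _∷_; lookup; tabulate)
import Data.Vec as Vec
open import Data.Vec.Properties using (lookup-map; lookup∘tabulate; lookup⇒[]=)
open import Function using (_∘_; _↔_; Injective)
open import Function.Bundles using (Inverse; Equivalence)
open import Function.Properties.Inverse using (↔-refl; ↔-sym; ↔-trans)
open import Relation.Binary.PropositionalEquality using (_≡_; _≢_; _≗_; refl; sym; trans; cong; cong₂; subst; subst₂)
open import Relation.Nullary using (¬_; Dec; contradiction; ¬?; ⌊_⌋; toWitness)
open import Relation.Nullary.Decidable using (from-yes; _×-dec_; _⊎-dec_; _→-dec_)

private variable
  A V W : Set

-- Counting the colours in a trace

data Status : Set where
  out red blue : Status

occupied isRed isBlue : Status → Bool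
occupied out = false
occupied _   = true
isRed red = true
isRed _   = false
isBlue blue = true
isBlue _    = false

tally : (V → Bool) → List V → ℕ
tally p []       = 0
tally p (v ∷ vs) = if p v then suc (tally p vs) else tally p vs

tally-++ : (p : V → Bool) (e f : List V) → tally p (e ++ f) ≡ tally p e + tally p f
tally-++ p []       f = refl
tally-++ p (v ∷ vs) f with p v
... | true  = cong suc (tally-++ p vs f)
... | false = tally-++ p vs f

tally-map : (p : W → Bool) (f : V → W) (e : List V) → tally p (map f e) ≡ tally (p ∘ f) e
tally-map p f []       = refl
tally-map p f (v ∷ vs) rewrite tally-map p f vs = refl

tally-cong : {p q : V → Bool} → p ≗ q → (e : List V) → tally p e ≡ tally q e
tally-cong p≗q []       = refl
tally-cong p≗q (v ∷ vs) rewrite p≗q v | tally-cong p≗q vs = refl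

tally-witness : (p : V → Bool) (e : List V) → tally p e ≢ 0 → ∃ λ v → v ∈ e × p v ≡ true
tally-witness p []       n≢0 = contradiction refl n≢0
tally-witness p (v ∷ vs) n≢0 with p v in eq
... | true  = v , here refl , eq
... | false = let u , u∈ , pu = tally-witness p vs n≢0 in u , there u∈ , pu

tally-occupied : (s : V → Status) (e : List V) →
  tally (occupied ∘ s) e ≡ tally (isRed ∘ s) e + tally (isBlue ∘ s) e
tally-occupied s []       = refl
tally-occupied s (v ∷ vs) with s v
... | out  = tally-occupied s vs
... | red  = cong suc (tally-occupied s vs)
... | blue = trans (cong suc (tally-occupied s vs)) (sym (ℕ.+-suc _ _))

-- A monochromatic trace on e has at most t vertices.
Shallow : ℕ → (V → Status) → List V → Set
Shallow t s e = (tally (isBlue ∘ s) e ≡ 0 → tally (isRed ∘ s) e ≤ t)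
              × (tally (isRed ∘ s) e ≡ 0 → tally (isBlue ∘ s) e ≤ t)

shallow-++ : ∀ {t u} (s : V → Status) (e f : List V) →
  Shallow t s e → Shallow u s f → Shallow (t + u) s (e ++ f)
shallow-++ {t = t} {u} s e f (re , be) (rf , bf) = half isRed isBlue re rf , half isBlue isRed be bf
  where
  half : (p q : Status → Bool) →
    (tally (q ∘ s) e ≡ 0 → tally (p ∘ s) e ≤ t) → (tally (q ∘ s) f ≡ 0 → tally (p ∘ s) f ≤ u) →
    tally (q ∘ s) (e ++ f) ≡ 0 → tally (p ∘ s) (e ++ f) ≤ t + u
  half p q he hf eq
    rewrite tally-++ (p ∘ s) e f | tally-++ (q ∘ s) e f =
    ℕ.+-mono-≤ (he (ℕ.m+n≡0⇒m≡0 _ eq)) (hf (ℕ.m+n≡0⇒n≡0 (tally (q ∘ s) e) eq))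

shallow-cong : ∀ {t} {s s′ : V → Status} (e : List V) → s ≗ s′ → Shallow t s e → Shallow t s′ e
shallow-cong e s≗s′ sh
  rewrite tally-cong (λ v → cong isRed (s≗s′ v)) e | tally-cong (λ v → cong isBlue (s≗s′ v)) e = sh

shallow-map : ∀ {t} (s : W → Status) (f : V → W) (e : List V) →
  Shallow t (s ∘ f) e → Shallow t s (map f e)
shallow-map s f e sh
  rewrite tally-map (isRed ∘ s) f e | tally-map (isBlue ∘ s) f e = sh

-- Colourings of all traces, and edges of a given type

record Painting (V : Set) : Set where
  field
    paint   : (V → Bool) → V → Status
    support : ∀ X v → occupied (paint X v) ≡ X v
open Painting

infixr 5 _⊕_
_⊕_ : Painting V → Painting W → Painting (V ⊎ W)
(P ⊕ Q) .paint X (inj₁ v) = P .paint (X ∘ inj₁) v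
(P ⊕ Q) .paint X (inj₂ w) = Q .paint (X ∘ inj₂) w
(P ⊕ Q) .support X (inj₁ v) = P .support (X ∘ inj₁) v
(P ⊕ Q) .support X (inj₂ w) = Q .support (X ∘ inj₂) w

-- The type of the set is (`size`, `depth`), and `i` is the colour it misses.
record Edge (P : Painting V) (c : V → Fin 3) (size depth : ℕ) (i : Fin 3) : Set where
  field
    vertices  : List V
    length≡   : length vertices ≡ size
    distinct  : Unique vertices
    avoids    : All (λ v → c v ≢ i) vertices
    shallow   : ∀ X → Shallow depth (P .paint X) vertices
open Edge

embed : {P : Painting V} {Q : Painting W} {c : W → Fin 3} {s d : ℕ} {i : Fin 3} (f : V → W) →
  Injective _≡_ _≡_ f → (∀ X v → P .paint (X ∘ f) v ≡ Q .paint X (f v)) →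
  Edge P (c ∘ f) s d i → Edge Q c s d i
embed f inj same e .vertices = map f (e .vertices)
embed f inj same e .length≡  = trans (length-map f (e .vertices)) (e .length≡)
embed f inj same e .distinct = UniqueP.map⁺ inj (e .distinct)
embed f inj same e .avoids   = AllP.map⁺ (e .avoids)
embed f inj same e .shallow X =
  shallow-map _ f (e .vertices) (shallow-cong (e .vertices) (same X) (e .shallow (X ∘ f)))

left : {P : Painting V} {Q : Painting W} {c : V ⊎ W → Fin 3} {s d : ℕ} {i : Fin 3} →
  Edge P (c ∘ inj₁) s d i → Edge (P ⊕ Q) c s d i
left = embed inj₁ inj₁-injective (λ _ _ → refl)

right : {P : Painting V} {Q : Painting W} {c : V ⊎ W → Fin 3} {s d : ℕ} {i : Fin 3} →
  Edge Q (c ∘ inj₂) s d i → Edge (P ⊕ Q) c s d i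
right = embed inj₂ inj₂-injective (λ _ _ → refl)

join : {P : Painting V} {Q : Painting W} {c : V ⊎ W → Fin 3} {s s′ d d′ : ℕ} {i : Fin 3} →
  Edge P (c ∘ inj₁) s d i → Edge Q (c ∘ inj₂) s′ d′ i → Edge (P ⊕ Q) c (s + s′) (d + d′) i
join {P = P} {Q} {c} {s} {s′} {d} {d′} {i} e f = union
  where
  e′ : Edge (P ⊕ Q) c s d i
  e′ = left e
  f′ : Edge (P ⊕ Q) c s′ d′ i
  f′ = right f
  union : Edge (P ⊕ Q) c (s + s′) (d + d′) i
  union .vertices = e′ .vertices ++ f′ .vertices
  union .length≡  = trans (length-++ (e′ .vertices)) (cong₂ _+_ (e′ .length≡) (f′ .length≡))
  union .distinct = UniqueP.++⁺ (e′ .distinct) (f′ .distinct) disjoint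
    where
    disjoint : ∀ {v} → ¬ (v ∈ e′ .vertices × v ∈ f′ .vertices)
    disjoint (p , q) with ∈-map⁻ inj₁ p | ∈-map⁻ inj₂ q
    ... | _ , _ , refl | _ , _ , ()
  union .avoids    = AllP.++⁺ (e′ .avoids) (f′ .avoids)
  union .shallow X = shallow-++ _ (e′ .vertices) (f′ .vertices) (e′ .shallow X) (f′ .shallow X)

-- Exhaustive checks by evaluation

vectors : List A → ∀ n → List (Vec A n)
vectors xs zero    = [] ∷ []
vectors xs (suc n) = cartesianProductWith _∷_ xs (vectors xs n)

∈-vectors : {xs : List A} → (∀ x → x ∈ xs) → ∀ {n} (v : Vec A n) → v ∈ vectors xs n
∈-vectors full []      = here refl
∈-vectors full (x ∷ v) = ∈-cartesianProductWith⁺ _∷_ (full x) (∈-vectors full v)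

bools : List Bool
bools = true ∷ false ∷ []

∈-bools : ∀ b → b ∈ bools
∈-bools true  = here refl
∈-bools false = there (here refl)

every-vector : (xs : List A) → (∀ x → x ∈ xs) → ∀ n (p : Vec A n → Bool) →
  all p (vectors xs n) ≡ true → ∀ v → T (p v)
every-vector xs full n p ok v =
  All.lookup (AllP.all⁺ p (vectors xs n) (Equivalence.from T-≡ ok)) (∈-vectors full v)

unless : ℕ → ℕ → ℕ → Bool
unless t zero    n = n ≤ᵇ t
unless t (suc _) n = true

shallow? : ℕ → (V → Status) → List V → Bool
shallow? t s e = unless t (tally (isBlue ∘ s) e) (tally (isRed ∘ s) e)
               ∧ unless t (tally (isRed ∘ s) e) (tally (isBlue ∘ s) e)

shallow?-sound : ∀ t (s : V → Status) e → T (shallow? t s e) → Shallow t s e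
shallow?-sound t s e ok = half reds blues (proj₁ ok′) , half blues reds (proj₂ ok′)
  where
  reds  = tally (isRed ∘ s) e
  blues = tally (isBlue ∘ s) e
  ok′ : T (unless t blues reds) × T (unless t reds blues)
  ok′ = Equivalence.to T-∧ ok
  half : ∀ m n → T (unless t n m) → n ≡ 0 → m ≤ t
  half m zero le refl = ℕ.≤ᵇ⇒≤ m t le

-- Alternation along a path

alternate : ∀ {n} → Bool → Vec Bool n → Vec Status n
alternate b     []          = []
alternate b     (false ∷ x) = out ∷ alternate b x
alternate true  (true ∷ x)  = red ∷ alternate false x
alternate false (true ∷ x)  = blue ∷ alternate true x

occupied-alternate : ∀ {n} b (x : Vec Bool n) i → occupied (lookup (alternate b x) i) ≡ lookup x i
occupied-alternate b     (false ∷ x) zero    = refl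
occupied-alternate true  (true ∷ x)  zero    = refl
occupied-alternate false (true ∷ x)  zero    = refl
occupied-alternate b     (false ∷ x) (suc i) = occupied-alternate b x i
occupied-alternate true  (true ∷ x)  (suc i) = occupied-alternate false x i
occupied-alternate false (true ∷ x)  (suc i) = occupied-alternate true x i

path : ∀ n → Painting (Fin n)
path n .paint X     = lookup (alternate true (tabulate X))
path n .support X i = trans (occupied-alternate true (tabulate X) i) (lookup∘tabulate X i)

-- Bundles of four-vertex paths

pairs triples : List (List (Fin 4))
pairs   = (# 0 ∷ # 1 ∷ []) ∷ (# 1 ∷ # 2 ∷ []) ∷ (# 2 ∷ # 3 ∷ []) ∷ []
triples = (# 0 ∷ # 1 ∷ # 2 ∷ []) ∷ (# 1 ∷ # 2 ∷ # 3 ∷ []) ∷ []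

Sound : ℕ → List (Fin 4) → Set
Sound size e = (length e ≡ size × Unique e)
  × all (λ x → shallow? 1 (lookup (alternate true x)) e) (vectors bools 4) ≡ true

sound? : ∀ size e → Dec (Sound size e)
sound? size e = ((length e ℕ.≟ size) ×-dec unique? e) ×-dec (_ ≟ᵇ true)
  where open DecUnique (_≟_ {4}) using (unique?)

-- Members of X within a run of consecutive path vertices are consecutive in X, so two of them
-- already show both colours.
pairs-sound : All (Sound 2) pairs
pairs-sound = from-yes (All.all? (sound? 2) pairs)

triples-sound : All (Sound 3) triples
triples-sound = from-yes (All.all? (sound? 3) triples)

starts-sound : All (Sound 2 ∘ take 2) triples
starts-sound = from-yes (All.all? (sound? 2 ∘ take 2) triples)

sound⇒edge : ∀ {c : Fin 4 → Fin 3} {size i e} → Sound size e →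
  All (λ v → c v ≢ i) e → Edge (path 4) c size 1 i
sound⇒edge {e = e} ((len , uniq) , ok) avoid = record
  { vertices = e ; length≡ = len ; distinct = uniq ; avoids = avoid
  ; shallow  = λ X → shallow?-sound 1 _ e
      (every-vector bools ∈-bools 4 (λ x → shallow? 1 (lookup (alternate true x)) e) ok (tabulate X)) }

PathChoice : (Fin 4 → Fin 3) → Set
PathChoice c = ∀ i → Any (All (λ v → c v ≢ i)) pairs ⊎ ∃ λ d → Any (All (λ v → c v ≢ d)) triples

pathChoice? : ∀ c → Dec (PathChoice c)
pathChoice? c = all? λ i → Any.any? (avoids? i) pairs ⊎-dec any? λ d → Any.any? (avoids? d) triples
  where
  avoids? : ∀ i e → Dec (All (λ v → c v ≢ i) e)
  avoids? i = All.all? (λ v → ¬? (c v ≟ i))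

pathChoice-vec : ∀ (w : Vec (Fin 3) 4) → PathChoice (lookup w)
pathChoice-vec w = toWitness
  (every-vector (allFin 3) ∈-allFin 4 (λ w → ⌊ pathChoice? (lookup w) ⌋) refl w)

-- If every consecutive pair meets colour i, then i occurs twice in some consecutive triple. The pair in the
-- second alternative is contained in the triple.
path-edges : ∀ (c : Fin 4 → Fin 3) i → Edge (path 4) c 2 1 i
  ⊎ ∃ λ d → Edge (path 4) c 3 1 d × Edge (path 4) c 2 1 d
path-edges c i = Sum.map fromPair fromTriple (pathChoice-vec (tabulate c) i)
  where
  recolour : ∀ {j e} → All (λ v → lookup (tabulate c) v ≢ j) e → All (λ v → c v ≢ j) e
  recolour = All.map λ {v} ne eq → ne (trans (lookup∘tabulate c v) eq)
  fromPair : Any (All (λ v → lookup (tabulate c) v ≢ i)) pairs → Edge (path 4) c 2 1 i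
  fromPair p = let e , e∈ , av = find p in sound⇒edge (All.lookup pairs-sound e∈) (recolour av)
  fromTriple : (∃ λ d → Any (All (λ v → lookup (tabulate c) v ≢ d)) triples) →
    ∃ λ d → Edge (path 4) c 3 1 d × Edge (path 4) c 2 1 d
  fromTriple (d , p) = let e , e∈ , av = find p in
    d , sound⇒edge (All.lookup triples-sound e∈) (recolour av)
      , sound⇒edge (All.lookup starts-sound e∈) (recolour (AllP.take⁺ 2 av))

Bundle : ℕ → Set
Bundle zero    = Fin 0
Bundle (suc n) = Fin 4 ⊎ Bundle n

bundle : ∀ n → Painting (Bundle n)
bundle zero    = path 0
bundle (suc n) = path 4 ⊕ bundle n

-- The type is that of one triple joined with `t d` pairs.
data Collected {V : Set} (P : Painting V) (c : V → Fin 3) (t : Fin 3 → ℕ) : Set where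
  collected : ∀ d → Edge P c (3 + t d * 2) (1 + t d) d → Collected P c t

-- By pigeonhole; x, y, z are the numbers of pairs still wanted for the missing colours 0, 1, 2.
collect : ∀ n x y z → x + y + z < n → (c : Bundle n → Fin 3) (i : Fin 3) →
  Edge (bundle n) c 2 1 i ⊎ Collected (bundle n) c (lookup (x ∷ y ∷ z ∷ []))
collect (suc n) x y z (s≤s bound) c i with path-edges (c ∘ inj₁) i
... | inj₁ pair = inj₁ (left pair)
-- No pair is wanted any more for this colour, so the triple alone is the collection.
collect (suc n) zero y z bound c i | inj₂ (zero , triple , pair) =
  inj₂ (collected (# 0) (left triple))
collect (suc n) x zero z bound c i | inj₂ (suc zero , triple , pair) =
  inj₂ (collected (# 1) (left triple))
collect (suc n) x y zero bound c i | inj₂ (suc (suc zero) , triple , pair) =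
  inj₂ (collected (# 2) (left triple))
collect (suc n) (suc x) y z (s≤s bound) c i | inj₂ (zero , triple , pair)
  with collect n x y z bound (c ∘ inj₂) i
... | inj₁ e = inj₁ (right e)
-- The recursive call wanted one pair fewer for colour 0 only. The pair of this path makes up for
-- it; edges for the other colours pass unchanged.
... | inj₂ (collected zero e) = inj₂ (collected (# 0) (join pair e))
... | inj₂ (collected (suc zero) e) = inj₂ (collected (# 1) (right e))
... | inj₂ (collected (suc (suc zero)) e) = inj₂ (collected (# 2) (right e))
collect (suc n) x (suc y) z (s≤s bound) c i | inj₂ (suc zero , triple , pair)
  with collect n x y z (subst (λ m → m + z ≤ n) (ℕ.+-suc x y) bound) (c ∘ inj₂) i
... | inj₁ e = inj₁ (right e)
... | inj₂ (collected zero e) = inj₂ (collected (# 0) (right e))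
... | inj₂ (collected (suc zero) e) = inj₂ (collected (# 1) (join pair e))
... | inj₂ (collected (suc (suc zero)) e) = inj₂ (collected (# 2) (right e))
collect (suc n) x y (suc z) (s≤s bound) c i | inj₂ (suc (suc zero) , triple , pair)
  with collect n x y z (subst (_≤ n) (ℕ.+-suc (x + y) z) bound) (c ∘ inj₂) i
... | inj₁ e = inj₁ (right e)
... | inj₂ (collected zero e) = inj₂ (collected (# 0) (right e))
... | inj₂ (collected (suc zero) e) = inj₂ (collected (# 1) (right e))
... | inj₂ (collected (suc (suc zero)) e) = inj₂ (collected (# 2) (join pair e))

-- Among 3k + 1 triples, each missing one of three colours, k + 1 miss the same one: one stays a
-- triple, k shrink to pairs.
paths : ℕ → ℕ
paths k = suc (k + k + k)

bundle-edges : ∀ k (c : Bundle (paths k) → Fin 3) i → Edge (bundle (paths k)) c 2 1 i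
  ⊎ ∃ λ d → Edge (bundle (paths k)) c (3 + k * 2) (1 + k) d
bundle-edges k c i = Sum.map₂ full (collect (paths k) k k k ℕ.≤-refl c i)
  where
  full : Collected (bundle (paths k)) c (lookup (k ∷ k ∷ k ∷ [])) →
    ∃ λ d → Edge (bundle (paths k)) c (3 + k * 2) (1 + k) d
  full (collected zero e)             = # 0 , e
  full (collected (suc zero) e)       = # 1 , e
  full (collected (suc (suc zero)) e) = # 2 , e

-- The step from h to h + 1

Finite : Set → Set
Finite V = ∃ λ n → V ↔ Fin n

finite-⊎ : Finite V → Finite W → Finite (V ⊎ W)
finite-⊎ (m , v) (n , w) = m + n , ↔-trans (v ⊎-↔ w) (↔-sym +↔⊎)

finite-bundle : ∀ n → Finite (Bundle n)
finite-bundle zero    = 0 , ↔-refl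
finite-bundle (suc n) = finite-⊎ (4 , ↔-refl) (finite-bundle n)

-- For h = k + 1, an h-heavy trace is larger than the depth k. The painting is fixed before `c`, so
-- it serves the edges of all colourings at once.
record Robust (k : ℕ) : Set₁ where
  field
    {Vertex} : Set
    finite   : Finite Vertex
    painting : Painting Vertex
    edge     : ∀ c → ∃ λ i → Edge painting c (1 + k * 2) k i

-- A pair missing the same `i` raises the type (2k+1, k) to (2k+3, k+1). Failing that, the bundle
-- alone supplies an edge of this type, possibly for another colour.
extend : ∀ {k} → Robust k → Robust (suc k)
extend {k} R = record
  { finite   = finite-⊎ (finite-bundle (paths k)) (R .finite)
  ; painting = bundle (paths k) ⊕ R .painting
  ; edge     = edge′ }
  where
  open Robust
  edge′ : ∀ c → ∃ λ i → Edge (bundle (paths k) ⊕ R .painting) c (3 + k * 2) (suc k) i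
  edge′ c with R .edge (c ∘ inj₂)
  ... | i , e with bundle-edges k (c ∘ inj₁) i
  ...   | inj₁ pair    = i , join pair e
  ...   | inj₂ (d , f) = d , left f

-- The case h = 4

possible : ∀ {n} → Vec Bool n → (Vec Status n → Bool) → Bool
possible []          test = test []
possible (false ∷ x) test = possible x (λ s → test (out ∷ s))
possible (true ∷ x)  test = possible x (λ s → test (red ∷ s)) ∨ possible x (λ s → test (blue ∷ s))

-- Greedy descent, taking red whenever some completion passes. Even if none passes, the result
-- colours exactly `x`, so it can serve in a painting.
choose : ∀ {n} → Vec Bool n → (Vec Status n → Bool) → Vec Status n
choose []          test = []
choose (false ∷ x) test = out ∷ choose x (λ s → test (out ∷ s))
choose (true ∷ x)  test =
  if possible x (λ s → test (red ∷ s))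
  then red ∷ choose x (λ s → test (red ∷ s))
  else blue ∷ choose x (λ s → test (blue ∷ s))

occupied-choose : ∀ {n} (x : Vec Bool n) test i → occupied (lookup (choose x test) i) ≡ lookup x i
occupied-choose (false ∷ x) test zero    = refl
occupied-choose (false ∷ x) test (suc i) = occupied-choose x (λ s → test (out ∷ s)) i
occupied-choose (true ∷ x)  test i with possible x (λ s → test (red ∷ s)) | i
... | true  | zero  = refl
... | true  | suc i = occupied-choose x (λ s → test (red ∷ s)) i
... | false | zero  = refl
... | false | suc i = occupied-choose x (λ s → test (blue ∷ s)) i

choose-passes : ∀ {n} (x : Vec Bool n) test → T (possible x test) → T (test (choose x test))
choose-passes []          test ok = ok
choose-passes (false ∷ x) test ok = choose-passes x (λ s → test (out ∷ s)) ok
choose-passes (true ∷ x)  test ok with possible x (λ s → test (red ∷ s)) in eq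
... | true  = choose-passes x (λ s → test (red ∷ s)) (subst T (sym eq) tt)
... | false = choose-passes x (λ s → test (blue ∷ s)) ok

Local : Set
Local = Fin 4 ⊎ Fin 7

-- The lines of the Fano plane are here i, i + 1, i + 3 modulo 7.
lineComplements : List (List (Fin 7))
lineComplements =
    (# 2 ∷ # 4 ∷ # 5 ∷ # 6 ∷ []) ∷ (# 0 ∷ # 3 ∷ # 5 ∷ # 6 ∷ []) ∷ (# 0 ∷ # 1 ∷ # 4 ∷ # 6 ∷ [])
  ∷ (# 0 ∷ # 1 ∷ # 2 ∷ # 5 ∷ []) ∷ (# 1 ∷ # 2 ∷ # 3 ∷ # 6 ∷ []) ∷ (# 0 ∷ # 2 ∷ # 3 ∷ # 4 ∷ [])
  ∷ (# 1 ∷ # 3 ∷ # 4 ∷ # 5 ∷ []) ∷ []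

-- inj₁ 0, 1, 2, 3 stand for the vertices of Q coloured a, a, b, c. The points 0, 1, 2 whose removal is paired
-- with b are not collinear, so every complement of a line meets both {0, 1, 2} and {3, 4, 5, 6}; when the trace
-- on the plane is such a complement, this provides the point that can be the only one of its colour.
family : List (List Local)
family = map (attach (# 0 ∷ # 1 ∷ # 3 ∷ [])) lineComplements
      ++ map (attach (# 0 ∷ # 1 ∷ # 2 ∷ [])) lineComplements
      ++ map (attach (# 2 ∷ []) ∘ others) (# 0 ∷ # 1 ∷ # 2 ∷ [])
      ++ map (attach (# 3 ∷ []) ∘ others) (# 3 ∷ # 4 ∷ # 5 ∷ # 6 ∷ [])
  where
  attach : List (Fin 4) → List (Fin 7) → List Local
  attach q u = map inj₁ q ++ map inj₂ u
  others : Fin 7 → List (Fin 7)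
  others v = Vec.toList (Vec.map (punchIn v) (Vec.allFin 6))

localStatus : Vec Status 4 → Vec Status 7 → Local → Status
localStatus τ σ = [ lookup τ , lookup σ ]′

good : List (List Local) → Vec Status 4 → Vec Status 7 → Bool
good F τ σ = all (shallow? 3 (localStatus τ σ)) F

-- Permuting Q by `arrange` destroys alternation but keeps the colour counts within one of each
-- other, so the search over the planes is checked for all such traces on Q.
balanced : Vec Status 4 → Bool
balanced τ = (reds ≤ᵇ suc blues) ∧ (blues ≤ᵇ suc reds)
  where
  reds  = tally isRed (Vec.toList τ)
  blues = tally isBlue (Vec.toList τ)

statuses : List Status
statuses = out ∷ red ∷ blue ∷ []

∈-statuses : ∀ s → s ∈ statuses
∈-statuses out  = here refl
∈-statuses red  = there (here refl)
∈-statuses blue = there (there (here refl))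

-- Taking the family as an argument, here and in missedᵇ, lets the evaluation share it.
allPossible : List (List Local) → Vec Status 4 → Bool
allPossible F τ = if balanced τ then all (λ x → possible x (good F τ)) (vectors bools 7) else true

abstract
  allPossible-holds : all (allPossible family) (vectors statuses 4) ≡ true
  allPossible-holds = refl

balanced⇒possible : ∀ τ → T (balanced τ) → ∀ x → T (possible x (good family τ))
balanced⇒possible τ bal =
  every-vector bools ∈-bools 7 (λ x → possible x (good family τ)) (Equivalence.to T-≡ (consequent (balanced τ) bal
    (every-vector statuses ∈-statuses 4 (allPossible family) allPossible-holds τ)))
  where
  consequent : ∀ b {y} → T b → T (if b then y else true) → T y
  consequent true _ ok = ok

-- One row for each choice of the two vertices of Q with the same colour, which come first.
roles : Fin 6 → Vec (Fin 4) 4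
roles = lookup ( (# 0 ∷ # 1 ∷ # 2 ∷ # 3 ∷ []) ∷ (# 0 ∷ # 2 ∷ # 1 ∷ # 3 ∷ []) ∷ (# 0 ∷ # 3 ∷ # 1 ∷ # 2 ∷ [])
               ∷ (# 1 ∷ # 2 ∷ # 0 ∷ # 3 ∷ []) ∷ (# 1 ∷ # 3 ∷ # 0 ∷ # 2 ∷ []) ∷ (# 2 ∷ # 3 ∷ # 0 ∷ # 1 ∷ []) ∷ [])

roles-injective : ∀ p x y → lookup (roles p) x ≡ lookup (roles p) y → x ≡ y
roles-injective = from-yes (all? λ p → all? λ x → all? λ y →
  (lookup (roles p) x ≟ lookup (roles p) y) →-dec (x ≟ y))

arrange : Fin 6 → Vec Status 4 → Vec Status 4
arrange p τ = Vec.map (lookup τ) (roles p)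

roles-balanced : ∀ p (x : Vec Bool 4) → T (balanced (arrange p (alternate true x)))
roles-balanced p = every-vector bools ∈-bools 4 (λ x → balanced (arrange p (alternate true x))) (ok p)
  where
  ok : ∀ p → all (λ x → balanced (arrange p (alternate true x))) (vectors bools 4) ≡ true
  ok = from-yes (all? λ p → all (λ x → balanced (arrange p (alternate true x))) (vectors bools 4) ≟ᵇ true)

-- The four-set Q with its six private Fano planes

Core : Set
Core = Fin 4 ⊎ (Fin 6 × Fin 7)

-- No edge will meet two planes, so each plane is coloured independently, from its own trace and the
-- trace on Q.
corePaint : (Core → Bool) → Core → Status
corePaint X (inj₁ q)       = path 4 .paint (X ∘ inj₁) q
corePaint X (inj₂ (p , v)) = lookup
  (choose (tabulate (λ v → X (inj₂ (p , v)))) (good family (arrange p (alternate true (tabulate (X ∘ inj₁)))))) v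

core : Painting Core
core .paint = corePaint
core .support X (inj₁ q)       = path 4 .support (X ∘ inj₁) q
core .support X (inj₂ (p , v)) =
  trans (occupied-choose (tabulate (λ v → X (inj₂ (p , v)))) _ v) (lookup∘tabulate (λ v → X (inj₂ (p , v))) v)

place : Fin 6 → Local → Core
place p = Sum.map (lookup (roles p)) (p ,_)

place-injective : ∀ p → Injective _≡_ _≡_ (place p)
place-injective p {inj₁ x} {inj₁ y} eq = cong inj₁ (roles-injective p x y (inj₁-injective eq))
place-injective p {inj₂ x} {inj₂ y} eq = cong (inj₂ ∘ proj₂) (inj₂-injective eq)

family-sound : All (λ e → length e ≡ 7 × Unique e) family
family-sound = from-yes (All.all? (λ e → (length e ℕ.≟ 7) ×-dec unique? e) family)
  where open DecUnique (SumP.≡-dec (_≟_ {4}) (_≟_ {7})) using (unique?)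

-- The trace on Q is balanced in every arrangement, so the search on plane `p` succeeds and makes
-- the whole family shallow at once.
place-edge : ∀ {c : Core → Fin 3} {i} p {e} → e ∈ family → All (λ v → c (place p v) ≢ i) e → Edge core c 7 3 i
place-edge {c} {i} p {e} e∈ avoid = record
  { vertices = map (place p) e
  ; length≡  = trans (length-map (place p) e) (proj₁ (All.lookup family-sound e∈))
  ; distinct = UniqueP.map⁺ (place-injective p) (proj₂ (All.lookup family-sound e∈))
  ; avoids   = AllP.map⁺ avoid
  ; shallow  = λ X → shallow-map (corePaint X) (place p) e (shallow-cong e (agree X) (local X)) }
  where
  trace : (Core → Bool) → Vec Status 4
  trace X = arrange p (alternate true (tabulate (X ∘ inj₁)))
  inner : (Core → Bool) → Vec Bool 7
  inner X = tabulate (λ v → X (inj₂ (p , v)))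
  local : ∀ X → Shallow 3 (localStatus (trace X) (choose (inner X) (good family (trace X)))) e
  local X = shallow?-sound 3 _ e (All.lookup (AllP.all⁺
    (shallow? 3 (localStatus (trace X) (choose (inner X) (good family (trace X))))) family
    (choose-passes (inner X) (good family (trace X))
      (balanced⇒possible (trace X) (roles-balanced p (tabulate (X ∘ inj₁))) (inner X)))) e∈)
  agree : ∀ X → localStatus (trace X) (choose (inner X) (good family (trace X))) ≗ corePaint X ∘ place p
  agree X (inj₁ q) = lookup-map q _ (roles p)
  agree X (inj₂ v) = refl

-- Three-colourings of the core

rolePattern : Vec (Fin 3) 4
rolePattern = # 0 ∷ # 0 ∷ # 1 ∷ # 2 ∷ []

rolePattern-onto : ∀ i → ∃ λ q → lookup rolePattern q ≡ i
rolePattern-onto = from-yes (all? λ i → any? λ q → lookup rolePattern q ≟ i)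

localColour : Vec (Fin 3) 7 → Local → Fin 3
localColour f = [ lookup rolePattern , lookup f ]′

Missed : List (List Local) → Vec (Fin 3) 7 → Set
Missed F f = ∃ λ i → Any (All (λ v → localColour f v ≢ i)) F

missed? : ∀ F f → Dec (Missed F f)
missed? F f = any? λ i → Any.any? (All.all? λ v → ¬? (localColour f v ≟ i)) F

missedᵇ : List (List Local) → Vec (Fin 3) 7 → Bool
missedᵇ F f = ⌊ missed? F f ⌋

abstract
  allMissed : all (missedᵇ family) (vectors (allFin 3) 7) ≡ true
  allMissed = refl

-- If two or more points have colour 0, then colour 1 or 2 occurs at most twice; a line through its
-- occurrences has a complement avoiding it. Otherwise six points avoid 0.
missed : ∀ f → Missed family f
missed f = toWitness (every-vector (allFin 3) ∈-allFin 7 (missedᵇ family) allMissed f)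

-- κ renames the colours a, b, c to 0, 1, 2.
Arranged : Vec (Fin 3) 4 → Fin 6 → Vec (Fin 3) 3 → Set
Arranged w p κ = ∀ q → lookup κ (lookup w (lookup (roles p) q)) ≡ lookup rolePattern q

Classified : Vec (Fin 3) 4 → Set
Classified w = (∃ λ i → ∀ q → lookup w q ≢ i) ⊎ ∃ λ p → Any (Arranged w p) (vectors (allFin 3) 3)

classified? : ∀ w → Dec (Classified w)
classified? w = any? (λ i → all? λ q → ¬? (lookup w q ≟ i))
  ⊎-dec any? λ p → Any.any? (λ κ → all? λ q → _ ≟ _) (vectors (allFin 3) 3)

abstract
  classified : ∀ w → Classified w
  classified w = toWitness (every-vector (allFin 3) ∈-allFin 4 (λ w → ⌊ classified? w ⌋) refl w)

few-colours-edge : ∀ (c : Core → Fin 3) {i} → (∀ q → c (inj₁ q) ≢ i) → Edge core c 4 1 i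
few-colours-edge c avoid = embed inj₁ inj₁-injective (λ _ _ → refl)
  (sound⇒edge {e = allFin 4} (from-yes (sound? 4 (allFin 4))) (All.tabulate λ {q} _ → avoid q))

arranged-edge : ∀ (c : Core → Fin 3) p κ → Arranged (tabulate (c ∘ inj₁)) p κ → ∃ λ i → Edge core c 7 3 i
-- The missed colour is read off a vertex of Q that `κ` renames to `i`, which replaces inverting
-- `κ`.
arranged-edge c p κ arranged = c (place p (inj₁ q)) , place-edge p e∈ (All.map (λ {v} → transfer v) avoid)
  where
  inner : Fin 7 → Fin 3
  inner v = lookup κ (c (inj₂ (p , v)))
  f = tabulate inner
  i = proj₁ (missed f)
  e∈ = proj₁ (proj₂ (find (proj₂ (missed f))))
  avoid = proj₂ (proj₂ (find (proj₂ (missed f))))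
  q = proj₁ (rolePattern-onto i)
  colour : ∀ v → localColour f v ≡ lookup κ (c (place p v))
  colour (inj₁ q) = trans (sym (arranged q)) (cong (lookup κ) (lookup∘tabulate (c ∘ inj₁) (lookup (roles p) q)))
  colour (inj₂ v) = lookup∘tabulate inner v
  transfer : ∀ v → localColour f v ≢ i → c (place p v) ≢ c (place p (inj₁ q))
  transfer v ne eq = ne (trans (colour v)
    (trans (cong (lookup κ) eq) (trans (sym (colour (inj₁ q))) (proj₂ (rolePattern-onto i)))))

core-edge : ∀ (c : Core → Fin 3) → (∃ λ i → Edge core c 7 3 i) ⊎ (∃ λ i → Edge core c 4 1 i)
core-edge c = [ (λ { (i , avoid) → inj₂ (i , few-colours-edge c λ q eq →
                       avoid q (trans (lookup∘tabulate (c ∘ inj₁) q) eq)) })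
              , (λ { (p , arrangements) → let κ , _ , arranged = find arrangements
                       in inj₁ (arranged-edge c p κ arranged) })
              ]′ (classified (tabulate (c ∘ inj₁)))

single : {P : Painting V} {c : V → Fin 3} {i : Fin 3} (v : V) → c v ≢ i → Edge P c 1 1 i
single {P = P} v ne = record
  { vertices = v ∷ [] ; length≡ = refl ; distinct = [] ∷ [] ; avoids = ne ∷ []
  ; shallow  = λ X → (λ _ → one (isRed ∘ P .paint X)) , λ _ → one (isBlue ∘ P .paint X) }
  where
  one : ∀ p → tally p (v ∷ []) ≤ 1
  one p with p v
  ... | true  = s≤s z≤n
  ... | false = z≤n

head-edge : {P : Painting V} {c : V → Fin 3} {s d : ℕ} {i : Fin 3} → Edge P c (suc s) d i → Edge P c 1 1 i
head-edge record { vertices = v ∷ _ ; avoids = ne ∷ _ } = single v ne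

-- The sizes are 4 + 2 + 1 = 7 and the depths 1 + 1 + 1 = 3; two bundles keep the extra vertex
-- disjoint from the pair. A bundle of `paths 2` without a suitable pair has an edge of type (3 + 2
-- * 2, 1 + 2) = (7, 3) itself.
base : Robust 3
base = record
  { finite   = finite-⊎ (finite-⊎ (4 , ↔-refl) (42 , ↔-sym *↔×))
      (finite-⊎ (finite-bundle (paths 2)) (finite-bundle (paths 2)))
  ; painting = painting
  ; edge     = edge }
  where
  painting = core ⊕ bundle (paths 2) ⊕ bundle (paths 2)
  edge : ∀ c → ∃ λ i → Edge painting c 7 3 i
  edge c with core-edge (c ∘ inj₁)
  ... | inj₁ (i , e) = i , left e
  ... | inj₂ (i , e) with bundle-edges 2 (c ∘ inj₂ ∘ inj₁) i | bundle-edges 2 (c ∘ inj₂ ∘ inj₂) i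
  ...   | inj₁ p       | inj₁ p′      = i , join e (join p (head-edge p′))
  ...   | inj₂ (d , f) | _            = d , right (left f)
  ...   | inj₁ _       | inj₂ (d , f) = d , right (right f)

robust : ∀ m → Robust (m + 3)
robust zero    = base
robust (suc m) = extend (robust m)

-- From edges as lists to the hypergraph

toSubset : ∀ {n} → List (Fin n) → Subset n
toSubset = foldr (λ v s → ⁅ v ⁆ ∪ s) ∅

∈-toSubset⁺ : ∀ {n} {v : Fin n} {l} → v ∈ l → v ∈ₛ toSubset l
∈-toSubset⁺ (here refl) = x∈p∪q⁺ (inj₁ (x∈⁅x⁆ _))
∈-toSubset⁺ (there v∈)  = x∈p∪q⁺ (inj₂ (∈-toSubset⁺ v∈))

∈-toSubset⁻ : ∀ {n} {v : Fin n} l → v ∈ₛ toSubset l → v ∈ l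
∈-toSubset⁻ []      v∈ = contradiction v∈ ∉⊥
∈-toSubset⁻ (u ∷ l) v∈ with x∈p∪q⁻ ⁅ u ⁆ (toSubset l) v∈
... | inj₁ v∈u = here (x∈⁅y⁆⇒x≡y u v∈u)
... | inj₂ v∈l = there (∈-toSubset⁻ l v∈l)

insert-size : ∀ {n} (v : Fin n) s → ¬ (v ∈ₛ s) → ∣ ⁅ v ⁆ ∪ s ∣ ≡ suc ∣ s ∣
insert-size zero    (outside ∷ s) v∉ = cong (suc ∘ ∣_∣) (∪-identityˡ s)
insert-size zero    (inside ∷ s)  v∉ = contradiction Vec.here v∉
insert-size (suc v) (outside ∷ s) v∉ = insert-size v s (v∉ ∘ Vec.there)
insert-size (suc v) (inside ∷ s)  v∉ = cong suc (insert-size v s (v∉ ∘ Vec.there))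

toSubset-size : ∀ {n} {l : List (Fin n)} → Unique l → ∣ toSubset l ∣ ≡ length l
toSubset-size {n} []            = ∣⊥∣≡0 n
toSubset-size {l = v ∷ l} (v∉ ∷ u) =
  trans (insert-size v (toSubset l) λ v∈ → All.lookup v∉ (∈-toSubset⁻ l v∈) refl) (cong suc (toSubset-size u))

-- An inequality, since `v` may already lie in `s`. It suffices for carrying heaviness of a trace
-- over to the tally of the list.
insert-trace : ∀ {n} (v : Fin n) s X →
  ∣ (⁅ v ⁆ ∪ s) ∩ X ∣ ≤ (if lookup X v then suc ∣ s ∩ X ∣ else ∣ s ∩ X ∣)
insert-trace zero (b ∷ s) (x ∷ X) rewrite ∪-identityˡ s with x | b
... | true  | true  = ℕ.n≤1+n _
... | true  | false = ℕ.≤-refl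
... | false | true  = ℕ.≤-refl
... | false | false = ℕ.≤-refl
insert-trace (suc v) (b ∷ s) (x ∷ X) with insert-trace v s X | b ∧ x
... | le | false = le
... | le | true with lookup X v
...   | true  = s≤s le
...   | false = s≤s le

trace-size : ∀ {n} (l : List (Fin n)) X → ∣ toSubset l ∩ X ∣ ≤ tally (lookup X) l
trace-size {n} [] X rewrite ∩-zeroˡ X = ℕ.≤-reflexive (∣⊥∣≡0 n)
trace-size (v ∷ l) X = ℕ.≤-trans (insert-trace v (toSubset l) X) (mono (lookup X v))
  where
  mono : ∀ b → (if b then suc ∣ toSubset l ∩ X ∣ else ∣ toSubset l ∩ X ∣)
             ≤ (if b then suc (tally (lookup X) l) else tally (lookup X) l)
  mono true  = s≤s (trace-size l X)
  mono false = trace-size l X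

bichromatic : ∀ {k} (s : V → Status) e → Shallow k s e → k < tally (occupied ∘ s) e →
  tally (isRed ∘ s) e ≢ 0 × tally (isBlue ∘ s) e ≢ 0
bichromatic {k = k} s e (red≤ , blue≤) k< =
    (λ eq → ℕ.<⇒≱ k<+ (subst (_≤ k) (cong (_+ blues) (sym eq)) (blue≤ eq)))
  , (λ eq → ℕ.<⇒≱ k<+ (subst (_≤ k) (trans (sym (ℕ.+-identityʳ reds)) (cong (reds +_) (sym eq))) (red≤ eq)))
  where
  reds  = tally (isRed ∘ s) e
  blues = tally (isBlue ∘ s) e
  k<+ : k < reds + blues
  k<+ = subst (k <_) (tally-occupied s e) k<

module _ {n k} (P : Painting (Fin n)) (E : ∀ c → ∃ λ i → Edge P c (1 + k * 2) k i) where
  edgeFor : (f : Vec (Fin 3) n) → Edge P (lookup f) (1 + k * 2) k (proj₁ (E (lookup f)))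
  edgeFor f = proj₂ (E (lookup f))

  edgeSet : Vec (Fin 3) n → Subset n
  edgeSet f = toSubset (edgeFor f .vertices)

  H : Hypergraph
  H = hypergraph n (map edgeSet (vectors (allFin 3) n))

  uniform : Uniform (1 + k * 2) H
  uniform = AllP.map⁺ (All.universal
    (λ f → trans (toSubset-size (edgeFor f .distinct)) (edgeFor f .length≡)) (vectors (allFin 3) n))

  -- The edge made for a colouring misses a colour under that very colouring.
  not-3-colourable : ¬ HasPolychromatic 3 H
  not-3-colourable (c , poly)
    with All.lookup (AllP.map⁻ poly) (∈-vectors ∈-allFin (tabulate c)) (proj₁ (E (lookup (tabulate c))))
  ... | v , v∈ , cv≡i = All.lookup (edgeFor (tabulate c) .avoids) (∈-toSubset⁻ _ v∈)
    (trans (lookup∘tabulate c v) cv≡i)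

  hue : Status → Fin 2
  hue red = # 0
  -- Vertices outside X share the hue of blue; the witnesses below all lie in X.
  hue _   = # 1

  -- The colouring painted for X serves every `F`: a monochromatic trace has at most k vertices, a
  -- heavy one more.
  traces-2-colourable : AllHeavyRestrictedTwoColorable (suc k) H
  traces-2-colourable X F F⊆ heavy = hue ∘ s , All.tabulate λ f∈ →
    bothHues (⊆-lookup F⊆ f∈) (All.lookup heavy f∈)
    where
    s : Fin n → Status
    s = P .paint (lookup X)
    bothHues : ∀ {f} → f ∈ traceEdges H X → suc k ≤ ∣ f ∣ → (i : Fin 2) → ∃ λ v → v ∈ₛ f × hue (s v) ≡ i
    bothHues f∈ k< with ∈-map⁻ (_∩ X) f∈
    ... | _ , g∈ , refl with ∈-map⁻ edgeSet g∈
    ...   | c , _ , refl = witnesses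
      where
      e : List (Fin n)
      e = edgeFor c .vertices
      both : tally (isRed ∘ s) e ≢ 0 × tally (isBlue ∘ s) e ≢ 0
      both = bichromatic s e (edgeFor c .shallow (lookup X))
        (subst (k <_) (tally-cong (λ v → sym (P .support (lookup X) v)) e) (ℕ.≤-trans k< (trace-size e X)))
      inTrace : ∀ {v} → v ∈ e → occupied (s v) ≡ true → v ∈ₛ edgeSet c ∩ X
      inTrace {v} v∈ occ = x∈p∩q⁺
        (∈-toSubset⁺ v∈ , lookup⇒[]= v X (trans (sym (P .support (lookup X) v)) occ))
      isRed⇒ : ∀ t → isRed t ≡ true → occupied t ≡ true × hue t ≡ # 0
      isRed⇒ red _ = refl , refl
      isBlue⇒ : ∀ t → isBlue t ≡ true → occupied t ≡ true × hue t ≡ # 1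
      isBlue⇒ blue _ = refl , refl
      witnesses : (i : Fin 2) → ∃ λ v → v ∈ₛ edgeSet c ∩ X × hue (s v) ≡ i
      witnesses zero =
        let v , v∈ , r = tally-witness (isRed ∘ s) e (proj₁ both) ; occ , eq = isRed⇒ (s v) r
        in v , inTrace v∈ occ , eq
      witnesses (suc zero) =
        let v , v∈ , b = tally-witness (isBlue ∘ s) e (proj₂ both) ; occ , eq = isBlue⇒ (s v) b
        in v , inTrace v∈ occ , eq

-- The counterexample for every h

Counterexample : ℕ → ℕ → Set
Counterexample m h = Σ Hypergraph λ H →
  Uniform m H × ¬ HasPolychromatic 3 H × AllHeavyRestrictedTwoColorable h H

robust⇒counterexample : ∀ {k} → Robust k → Counterexample (1 + k * 2) (suc k)
robust⇒counterexample {k} R = H P E , uniform P E , not-3-colourable P E , traces-2-colourable P E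
  where
  open Robust R
  open Inverse (proj₂ finite) using (to; from; strictlyInverseˡ; strictlyInverseʳ)
  P : Painting (Fin (proj₁ finite))
  P .paint X     = painting .paint (X ∘ to) ∘ from
  P .support X v = trans (painting .support (X ∘ to) (from v)) (cong X (strictlyInverseˡ v))
  to-injective : Injective _≡_ _≡_ to
  to-injective {x} {y} eq = trans (sym (strictlyInverseʳ x)) (trans (cong from eq) (strictlyInverseʳ y))
  E : ∀ c → ∃ λ i → Edge P c (1 + k * 2) k i
  E c = let i , e = edge (c ∘ to) in i , embed to to-injective
    (λ X v → cong (painting .paint (X ∘ to)) (sym (strictlyInverseʳ v))) e

theorem2 : (h : ℕ) → 4 ≤ h →
    Σ Hypergraph λ H →
    Uniform (2 * h ∸ 1) H × ¬ HasPolychromatic 3 H × AllHeavyRestrictedTwoColorable h H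
-- `robust m` has k = m + 3 and so treats h = m + 4.
theorem2 h 4≤h = subst₂ Counterexample size k+1≡h (robust⇒counterexample (robust (h ∸ 4)))
  where
  k+1≡h : suc (h ∸ 4 + 3) ≡ h
  k+1≡h = trans (sym (ℕ.+-suc (h ∸ 4) 3)) (ℕ.m∸n+n≡m 4≤h)
  size : 1 + (h ∸ 4 + 3) * 2 ≡ 2 * h ∸ 1
  size = cong (_∸ 1) (trans (ℕ.*-comm (suc (h ∸ 4 + 3)) 2) (cong (2 *_) k+1≡h))
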